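{- Let $G=(V,E,w)$ be a finite connected graph with $|V|=n\ge2$ and weights $w:E\to\mathbb{R}_{>0}$. Let $T\in\mathcal T_{\mathrm{conn}}^{\mathrm{bin}}(G)$ satisfy $$F(T)\le\alpha\operatorname{OPT}_{\mathrm{free}}(G,w)$$ for some $\alpha\ge1$. Suppose that a function $\Phi:[1,n-1]\to\mathbb R_{\ge0}$ satisfies $$\mu_T\bigl(\{S:\rho_T(S)>t\}\bigr)\le\Phi(t)\qquad\text{for every }t\in[1,n-1].$$ Then $$\operatorname{OPT}_{\mathrm{card}}(G,w)\le\alpha\left(1+\int_1^{n-1}\Phi(t)\,dt\right)\operatorname{OPT}_{\mathrm{free}}(G,w).$$
   Context: $d_G$ is the shortest-path metric of $(V,E)$ with every edge of length $1$ (weights are not lengths); $\operatorname{diam}_{d_G}(S)=\max_{a,b\in S}d_G(a,b)$. A rooted binary hierarchy $T$ on $V$ is a rooted tree whose leaves are the vertices of $V$ and whose internal nodes have exactly two children; each node is identified with the set of leaves below it (a cluster); $C_T(x,y)$ is the cluster of the lowest common ancestor of $x,y$. $\mathcal T_{\mathrm{conn}}^{\mathrm{bin}}(G)$ is the set of rooted binary hierarchies on $V$ all of whose clusters induce connected subgraphs of $G$. $\mathcal I(T)$ is the family of internal (non-leaf) clusters. For $S\in\mathcal I(T)$ with children $S^0,S^1$: $b_T(S)$ is the total weight of edges with one endpoint in $S^0$ and the other in $S^1$; $\Delta_T(S)=\operatorname{diam}_{d_G}(S)$; $a_T(S)=\Delta_T(S)b_T(S)$; $\rho_T(S)=(|S|-1)/\Delta_T(S)$.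 $F(T)=\sum_{xy\in E}w_{xy}\operatorname{diam}_{d_G}(C_T(x,y))>0$, and $\mu_T(S)=a_T(S)/F(T)$ for $S\in\mathcal I(T)$, which defines a probability measure on $\mathcal I(T)$; the set $\{S:\rho_T(S)>t\}$ consists of clusters $S\in\mathcal I(T)$. $\operatorname{OPT}_{\mathrm{free}}(G,w)$ is the minimum of $\sum_{xy\in E}w_{xy}u(x,y)$ over all ultrametrics $u$ on $V$ (metrics with $u(x,y)\le\max\{u(x,z),u(z,y)\}$ for all $x,y,z$) with $u\ge d_G$ on all pairs. For a rooted binary hierarchy $H$ on $V$ put $h_H(x,x)=0$ and $h_H(x,y)=|C_H(x,y)|-1$ for $x\ne y$; $\operatorname{OPT}_{\mathrm{card}}(G,w)$ is the minimum of $\sum_{xy\in E}w_{xy}h_H(x,y)$ over all rooted binary hierarchies $H$ on $V$ with $h_H\ge d_G$ on all pairs. -}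

module Defs where

open import Algebra.Bundles using (CommutativeRing)
import Algebra.Construct.NaturalChoice.Max as NaturalMax
import Algebra.Properties.CommutativeMonoid.Sum as Sum
import Algebra.Properties.Semiring.Mult as Mult
open import Data.Bool.Base using (if_then_else_)
open import Data.Fin.Base as Fin using (Fin)
open import Data.Fin.Properties as Fin using (any?)
open import Data.Fin.Subset using (Subset; _∈_; ⁅_⁆; _∪_; ∣_∣)
open import Data.Fin.Subset.Properties using (_∈?_)
open import Data.List.Base using (List; []; _∷_; [_]; _++_; map; foldr; filter; allFin)
open import Data.List.Relation.Unary.All using (All)
open import Data.List.Relation.Binary.Permutation.Propositional using (_↭_)
open import Data.Nat.Base as ℕ using (ℕ; zero; suc; _∸_; z≤n; s≤s)
open import Data.Product.Base using (Σ; ∃; ∃-syntax; _×_; _,_; proj₁)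
import Data.Vec.Functional as Vector
import Function.Metric.Structures as Metric
open import Level as Level using (0ℓ)
open import Relation.Binary.Bundles using (DecTotalOrder)
open import Relation.Binary.Core using (Rel)
import Relation.Binary.Construct.NonStrictToStrict as ToStrict
open import Relation.Binary.Definitions using (Symmetric; Irreflexive; Decidable)
open import Relation.Binary.PropositionalEquality using (_≡_; refl)
open import Relation.Binary.Structures using (IsDecTotalOrder)
open import Relation.Nullary using (Dec; yes; no; ¬_; does; contradiction)
open import Relation.Nullary.Decidable using (_×-dec_; _⊎-dec_)
import Relation.Unary as U
open import Relation.Unary using (Pred)

module Bounds {A : Set} (_≤_ : Rel A 0ℓ) where

  IsUpperBound IsLowerBound : ∀ {ℓ} → Pred A ℓ → A → Set ℓ
  IsUpperBound P u = ∀ x → P x → x ≤ u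
  IsLowerBound P l = ∀ x → P x → l ≤ x

  IsSupremum IsInfimum IsMinimum : ∀ {ℓ} → Pred A ℓ → A → Set ℓ
  IsSupremum P s = IsUpperBound P s × (∀ u → IsUpperBound P u → s ≤ u)
  IsInfimum  P i = IsLowerBound P i × (∀ l → IsLowerBound P l → l ≤ i)
  IsMinimum  P m = P m × IsLowerBound P m

-- Axioms for the real numbers, which determine them up to isomorphism.  The
-- reals are the classical ones: the order is decidable, and division is made
-- total by leaving 0# ⁻¹ unspecified.

record CompleteOrderedField : Set₁ where
  infix  4 _≤_
  infix  8 _⁻¹
  field
    commutativeRing : CommutativeRing 0ℓ 0ℓ

  open CommutativeRing commutativeRing public

  field
    _≤_             : Rel Carrier 0ℓ
    isDecTotalOrder : IsDecTotalOrder _≈_ _≤_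
    _⁻¹             : Carrier → Carrier
    0≉1             : ¬ 0# ≈ 1#
    ⁻¹-cong         : ∀ {x y} → x ≈ y → x ⁻¹ ≈ y ⁻¹
    ⁻¹-inverseʳ     : ∀ x → ¬ x ≈ 0# → x * x ⁻¹ ≈ 1#
    +-monoʳ-≤       : ∀ x {y z} → y ≤ z → x + y ≤ x + z
    *-nonNegative   : ∀ {x y} → 0# ≤ x → 0# ≤ y → 0# ≤ x * y
    supremum        : ∀ (P : Pred Carrier 0ℓ) → ∃ P →
                      ∃ (Bounds.IsUpperBound _≤_ P) →
                      ∃ (Bounds.IsSupremum _≤_ P)

  decTotalOrder : DecTotalOrder 0ℓ 0ℓ 0ℓ
  decTotalOrder = record { isDecTotalOrder = isDecTotalOrder }

  open DecTotalOrder decTotalOrder public using (totalOrder; _≤?_; _≟_)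
  open Bounds _≤_ public
  open ToStrict _≈_ _≤_ public using (_<_)
  open NaturalMax totalOrder public using () renaming (_⊔_ to max)
  open Sum +-commutativeMonoid public using (sum)
  open Mult semiring public using () renaming (_×_ to _·_)

  _<?_ : Decidable _<_
  _<?_ = ToStrict.<-decidable _≈_ _≤_ _≟_ _≤?_

  fromℕ : ℕ → Carrier
  fromℕ k = k · 1#

  listSum : List Carrier → Carrier
  listSum = foldr _+_ 0#

  indicator : ∀ {ℓ} {P : Set ℓ} → Dec P → Carrier
  indicator P? = if does P? then 1# else 0#

  [_⋯_] : Carrier → Carrier → Pred Carrier 0ℓ
  [ a ⋯ b ] t = a ≤ t × t ≤ b


module Lebesgue (ℝ : CompleteOrderedField) where

  open CompleteOrderedField ℝ

  -- A is covered by countably many intervals (l k , r k) of total length ≤ s.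
  CoverableBy : Pred Carrier 0ℓ → Pred Carrier 0ℓ
  CoverableBy A s = Σ (ℕ → Carrier) λ l → Σ (ℕ → Carrier) λ r →
    (∀ k → l k ≤ r k) ×
    (∀ x → A x → ∃[ k ] (l k < x × x < r k)) ×
    (∀ N → sum {N} (λ k → r (Fin.toℕ k) - l (Fin.toℕ k)) ≤ s)

  IsOuterMeasure : Pred Carrier 0ℓ → Carrier → Set
  IsOuterMeasure A = IsInfimum (CoverableBy A)

  IsOpen : Pred Carrier 0ℓ → Set
  IsOpen A = ∀ x → A x →
    ∃[ ε ] (0# < ε × ∀ y → x - ε < y → y < x + ε → A y)

  Measurable : Pred Carrier 0ℓ → Set₁
  Measurable E = ∀ ε → 0# < ε → Σ (Pred Carrier 0ℓ) λ O →
    IsOpen O × (∀ x → E x → O x) ×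
    ∃[ m ] (IsOuterMeasure (λ x → O x × ¬ E x) m × m ≤ ε)

  MeasurableOn : Carrier → Carrier → (Carrier → Carrier) → Set₁
  MeasurableOn a b f = ∀ c → Measurable (λ t → [ a ⋯ b ] t × c < f t)

  -- The function Σᵢ coeff i · 1_{piece i} on [ a ⋯ b ].
  record Simple (a b : Carrier) : Set₁ where
    field
      size       : ℕ
      coeff      : Fin size → Carrier
      coeff≥0    : ∀ i → 0# ≤ coeff i
      piece      : Fin size → Pred Carrier 0ℓ
      piece?     : ∀ i → U.Decidable (piece i)
      inside     : ∀ i t → piece i t → [ a ⋯ b ] t
      measurable : ∀ i → Measurable (piece i)
      measure    : Fin size → Carrier
      isMeasure  : ∀ i → IsOuterMeasure (piece i) (measure i)

    value : Carrier → Carrier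
    value t = sum (λ i → coeff i * indicator (piece? i t))

    integral : Carrier
    integral = sum (λ i → coeff i * measure i)

  -- I is the (finite) Lebesgue integral over [ a ⋯ b ] of the function f,
  -- which is nonnegative there.
  IsIntegral : Carrier → Carrier → (Carrier → Carrier) → Carrier → Set₁
  IsIntegral a b f I = MeasurableOn a b f × IsSupremum IntegralBelow I
    where
    IntegralBelow : Pred Carrier (Level.suc 0ℓ)
    IntegralBelow J = Σ (Simple a b) λ s → let open Simple s in
      (∀ t → [ a ⋯ b ] t → value t ≤ f t) × integral ≈ J


Walk : {A : Set} → Rel A 0ℓ → ℕ → Rel A 0ℓ
Walk R zero    x y = x ≡ y
Walk R (suc k) x y = ∃[ z ] (R x z × Walk R k z y)

walk? : ∀ {n} {R : Rel (Fin n) 0ℓ} → Decidable R → ∀ k → Decidable (Walk R k)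
walk? R? zero    x y = x Fin.≟ y
walk? R? (suc k) x y = any? λ z → R? x z ×-dec walk? R? k z y

least : ∀ {P : Pred ℕ 0ℓ} → U.Decidable P → ∀ k → P k →
        ∃ (Bounds.IsMinimum ℕ._≤_ P)
least P? zero    p = zero , p , λ _ _ → z≤n
least P? (suc k) p with P? zero
... | yes p₀ = zero , p₀ , λ _ _ → z≤n
... | no ¬p₀ with least (λ j → P? (suc j)) k p
...   | m , q , min = suc m , q , λ where
        zero    p₀ → contradiction p₀ ¬p₀
        (suc j) p  → s≤s (min j p)


-- w x y is only meaningful when x and y are adjacent.
record WeightedGraph (ℝ : CompleteOrderedField) (n : ℕ) : Set₁ where
  open CompleteOrderedField ℝ using (Carrier; _≈_; _<_; 0#)
  field
    Adj       : Rel (Fin n) 0ℓ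
    adj?      : Decidable Adj
    symmetric : Symmetric Adj
    loopless  : Irreflexive _≡_ Adj
    connected : ∀ x y → ∃[ k ] Walk Adj k x y
    w         : Fin n → Fin n → Carrier
    w-sym     : ∀ {x y} → Adj x y → w x y ≈ w y x
    w-pos     : ∀ {x y} → Adj x y → 0# < w x y


data Tree (n : ℕ) : Set where
  leaf : Fin n → Tree n
  node : Tree n → Tree n → Tree n

-- An internal cluster, presented by its two children.
record Internal (n : ℕ) : Set where
  constructor internal
  field
    child⁰ child¹ : Subset n

  cluster : Subset n
  cluster = child⁰ ∪ child¹

module _ {n : ℕ} where

  leaves : Tree n → List (Fin n)
  leaves (leaf x)   = [ x ]
  leaves (node l r) = leaves l ++ leaves r

  root : Tree n → Subset n
  root (leaf x)   = ⁅ x ⁆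
  root (node l r) = root l ∪ root r

  clusters : Tree n → List (Subset n)
  clusters (leaf x)     = [ root (leaf x) ]
  clusters t@(node l r) = root t ∷ clusters l ++ clusters r

  internals : Tree n → List (Internal n)
  internals (leaf x)   = []
  internals (node l r) = internal (root l) (root r) ∷ internals l ++ internals r

  lca : Tree n → Fin n → Fin n → Subset n
  lca t@(leaf _)   x y = root t
  lca t@(node l r) x y =
    if does (x ∈? root l ×-dec y ∈? root l) then lca l x y else
    if does (x ∈? root r ×-dec y ∈? root r) then lca r x y else
    root t

-- Every vertex labels exactly one leaf, so distinct nodes have distinct
-- clusters and `internals tree` lists each internal cluster once.  The order
-- of the two children of a node is immaterial to everything defined below.
record Hierarchy (n : ℕ) : Set where
  field
    tree  : Tree n
    spans : leaves tree ↭ allFin n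


module GraphHierarchies {ℝ : CompleteOrderedField} {n : ℕ}
                        (G : WeightedGraph ℝ n) where

  open CompleteOrderedField ℝ
  open WeightedGraph G

  dist : Fin n → Fin n → ℕ
  dist x y = let k , walk = connected x y in
             proj₁ (least (λ k → walk? adj? k x y) k walk)

  maximum : ∀ {m} → (Fin m → ℕ) → ℕ
  maximum = Vector.foldr ℕ._⊔_ 0

  diam : Subset n → ℕ
  diam S = maximum λ a → maximum λ b →
    if does (a ∈? S ×-dec b ∈? S) then dist a b else 0

  -- Σ_{xy ∈ E} w_{xy} f x y, each edge being listed with its smaller end first.
  edgeSum : (Fin n → Fin n → Carrier) → Carrier
  edgeSum f = sum λ x → sum λ y →
    indicator (x Fin.<? y ×-dec adj? x y) * (w x y * f x y)

  InducesConnected : Subset n → Set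
  InducesConnected S = ∀ x y → x ∈ S → y ∈ S →
    ∃[ k ] Walk (λ a b → a ∈ S × b ∈ S × Adj a b) k x y

  IsConnected : Hierarchy n → Set
  IsConnected T = All InducesConnected (clusters (Hierarchy.tree T))

  F : Hierarchy n → Carrier
  F T = edgeSum λ x y → fromℕ (diam (lca (Hierarchy.tree T) x y))

  Δ : Internal n → ℕ
  Δ S = diam (Internal.cluster S)

  b a ρ : Internal n → Carrier
  b S = edgeSum λ x y → indicator
    ((x ∈? child⁰ ×-dec y ∈? child¹) ⊎-dec (x ∈? child¹ ×-dec y ∈? child⁰))
    where open Internal S
  a S = fromℕ (Δ S) * b S
  ρ S = fromℕ (∣ Internal.cluster S ∣ ∸ 1) * fromℕ (Δ S) ⁻¹

  μ : Hierarchy n → {P : Pred (Internal n) 0ℓ} → U.Decidable P → Carrier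
  μ T P? = listSum (map (λ S → a S * F T ⁻¹)
                        (filter P? (internals (Hierarchy.tree T))))

  IsUltrametric : (Fin n → Fin n → Carrier) → Set
  IsUltrametric = Metric.IsGeneralMetric _≡_ _≈_ _≤_ 0# max

  FreeCost : Pred Carrier 0ℓ
  FreeCost c = ∃[ u ] (IsUltrametric u × (∀ x y → fromℕ (dist x y) ≤ u x y) ×
                       edgeSum u ≈ c)

  IsOPTfree : Pred Carrier 0ℓ
  IsOPTfree = IsMinimum FreeCost

  h : Hierarchy n → Fin n → Fin n → ℕ
  h H x y = if does (x Fin.≟ y) then 0
            else ∣ lca (Hierarchy.tree H) x y ∣ ∸ 1

  CardCost : Pred Carrier 0ℓ
  CardCost c = ∃[ H ] ((∀ x y → dist x y ℕ.≤ h H x y) ×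
                       edgeSum (λ x y → fromℕ (h H x y)) ≈ c)

  IsOPTcard : Pred Carrier 0ℓ
  IsOPTcard = IsMinimum CardCost

{-# OPTIONS --safe #-}
module Submission where

-- The hierarchy T itself is a competitor for OPTcard.  Its clusters induce
-- connected subgraphs, and two vertices of a connected set S are joined by a
-- path without repeated vertices inside S, so their distance is at most
-- |S| - 1 (h-dominates).
--
-- The costs of T are compared cluster by cluster.  An edge xy crosses between
-- the two children of exactly one internal cluster, the lca of x and y, so a
-- cost of the form Σ w f(lca) is the sum of f(S) b(S) over the internal
-- clusters (cost-by-cluster).  For f = diam this gives F(T) = Σ a(S), whence
-- the masses μ(S) = a(S) / F(T) have sum 1; for f = |S| - 1 it gives the cost
-- of h, and (|S| - 1) b(S) = ρ(S) a(S) turns that cost into F(T) Σ ρ(S) μ(S).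
-- Since the masses sum to 1, it equals F(T) (1 + E) with
-- E = Σ μ(S) (ρ(S) - 1) (h-cost).
--
-- By the layer-cake formula, E is the integral over t in [1, n-1] of the tail
-- μ{ρ > t}.  Only E ≤ ∫ Φ is required, and it follows from the definition of
-- the integral as a supremum: Σ μ(S) 1_(1, ρ(S)) is a simple function with
-- integral E lying below the tail, and hence below Φ (excess≤integral).  That
-- 1 ≤ ρ(S) ≤ n - 1 follows from 1 ≤ diam S ≤ |S| - 1.  So
--   OPTcard ≤ F(T) (1 + E) ≤ F(T) (1 + ∫ Φ) ≤ α OPTfree (1 + ∫ Φ).
--
-- The analytic core is that an open interval (a, b) has outer measure b - a,
-- i.e. that a countable cover by open intervals has total length at least
-- b - a (interval-cover).  Instead of extracting a finite subcover, a supremum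
-- argument moves along the interval: it looks at the points x up to which
-- finitely many members of the cover already account for the length x - a.
--
-- The logic is constructive, but inequalities between reals are decidable,
-- so they may be proved by contradiction.

import Algebra.Bundles as Bundles
import Algebra.Construct.NaturalChoice.Max as NaturalMax
import Algebra.Construct.NaturalChoice.Min as NaturalMin
import Algebra.Properties.CommutativeMonoid.Sum as Sum
import Algebra.Properties.CommutativeSemigroup as CommutativeSemigroupProperties
import Algebra.Properties.Group as GroupProperties
import Algebra.Properties.Ring as RingProperties
import Algebra.Properties.Semiring.Sum as SemiringSum
open import Data.Bool.Base using (if_then_else_)
open import Data.Fin.Base as Fin using (Fin)
import Data.Fin.Properties as Fin
open import Data.Fin.Subset using (Subset; _∈_; _∉_; ∣_∣)
import Data.Fin.Subset as Subset
open import Data.Fin.Subset.Properties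
  using (_∈?_; x∈⁅x⁆; x∈⁅y⁆⇒x≡y; x∈p∪q⁺; x∈p∪q⁻; p⊆p∪q; q⊆p∪q;
         x∈p∧x≢y⇒x∈p-y; x∈p⇒∣p-x∣<∣p∣; ∣p∣≤n)
open import Data.List.Base using (List; []; _∷_; _++_; map; filter; length; lookup)
open import Data.List.Membership.Propositional using () renaming (_∈_ to _∈ˡ_)
open import Data.List.Membership.Propositional.Properties
  using (∈-++⁺ˡ; ∈-++⁺ʳ; ∈-++⁻; ∈-allFin; ∈-lookup)
open import Data.List.Relation.Binary.Permutation.Propositional using (↭-sym; ↭⇒↭ₛ)
open import Data.List.Relation.Binary.Permutation.Propositional.Properties
  using (∈-resp-↭)
import Data.List.Relation.Binary.Permutation.Setoid.Properties as Permutation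
open import Data.List.Relation.Unary.All as All using (All; []; _∷_)
import Data.List.Relation.Unary.All.Properties as All
open import Data.List.Relation.Unary.AllPairs using ([]; _∷_)
open import Data.List.Relation.Unary.Any using (here; there)
open import Data.List.Relation.Unary.Unique.Propositional using (Unique)
open import Data.List.Relation.Unary.Unique.Propositional.Properties using (allFin⁺)
open import Data.Nat.Base as ℕ using (ℕ; zero; suc; _∸_; z≤n; s≤s)
import Data.Nat.Properties as ℕ
open import Data.Product.Base as Product using (∃-syntax; _×_; _,_; proj₁; proj₂)
open import Data.Sum.Base using (_⊎_; inj₁; inj₂)
open import Data.Unit.Base using (⊤)
open import Function.Base using (_∘_)
open import Level using (0ℓ)
open import Relation.Binary.Bundles using (DecTotalOrder)
open import Relation.Binary.Core using (Rel)
import Relation.Binary.Properties.DecTotalOrder as DecTotalOrderProperties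
open import Relation.Binary.PropositionalEquality as ≡ using (_≡_; _≢_)
import Relation.Binary.Reasoning.PartialOrder as PartialOrderReasoning
open import Relation.Nullary using (Dec; yes; no; ¬_; does; contradiction)
open import Relation.Nullary.Decidable
  using (_×-dec_; _⊎-dec_; dec-true; dec-false; decidable-stable)
open import Relation.Unary as U using (Pred)

open import Defs

if-elim : ∀ {a q} {A : Set a} {P : Set} (P? : Dec P) {u v : A} (Q : A → Set q) →
          (P → Q u) → (¬ P → Q v) → Q (if does P? then u else v)
if-elim (yes p) Q qᵤ qᵥ = qᵤ p
if-elim (no ¬p) Q qᵤ qᵥ = qᵥ ¬p

-- Ordered fields

module OrderedField (ℝ : CompleteOrderedField) where
  open CompleteOrderedField ℝ
  open DecTotalOrder decTotalOrder public
    using (poset; total; antisym)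
    renaming (refl to ≤-refl; reflexive to ≤-reflexive; trans to ≤-trans)
  open DecTotalOrderProperties decTotalOrder public
    using (<⇒≱; ≰⇒>)
  open PartialOrderReasoning poset
  open RingProperties (Bundles.CommutativeRing.ring commutativeRing)
    using (-1*x≈-x)
  open GroupProperties +-group public
    using ()
    renaming
      ( ⁻¹-involutive    to -‿involutive
      ; //-rightDividesˡ to x-y+y≈x
      ; //-rightDividesʳ to x+y-y≈x
      )

  <⇒≤ : ∀ {x y} → x < y → x ≤ y
  <⇒≤ = proj₁

  ≤-<-trans : ∀ {x y z} → x ≤ y → y < z → x < z
  ≤-<-trans {x} {y} {z} x≤y y<z = begin-strict x ≤⟨ x≤y ⟩ y <⟨ y<z ⟩ z ∎

  +-monoˡ-≤ : ∀ z {x y} → x ≤ y → x + z ≤ y + z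
  +-monoˡ-≤ z {x} {y} x≤y = begin
    x + z  ≈⟨ +-comm x z ⟩
    z + x  ≤⟨ +-monoʳ-≤ z x≤y ⟩
    z + y  ≈⟨ +-comm z y ⟩
    y + z  ∎

  <-≤-trans : ∀ {x y z} → x < y → y ≤ z → x < z
  <-≤-trans {x} {y} {z} x<y y≤z = begin-strict x <⟨ x<y ⟩ y ≤⟨ y≤z ⟩ z ∎

  +-mono-≤ : ∀ {x y u v} → x ≤ y → u ≤ v → x + u ≤ y + v
  +-mono-≤ {y = y} {u} x≤y u≤v = ≤-trans (+-monoˡ-≤ u x≤y) (+-monoʳ-≤ y u≤v)

  +-cancelʳ-≤ : ∀ z {x y} → x + z ≤ y + z → x ≤ y
  +-cancelʳ-≤ z {x} {y} le = begin
    x          ≈⟨ x+y-y≈x z x ⟨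
    x + z - z  ≤⟨ +-monoˡ-≤ (- z) le ⟩
    y + z - z  ≈⟨ x+y-y≈x z y ⟩
    y          ∎

  x≤y⇒0≤y-x : ∀ {x y} → x ≤ y → 0# ≤ y - x
  x≤y⇒0≤y-x {x} {y} x≤y = begin
    0#     ≈⟨ -‿inverseʳ x ⟨
    x - x  ≤⟨ +-monoˡ-≤ (- x) x≤y ⟩
    y - x  ∎

  x+z≤y⇒x≤y-z : ∀ {x y z} → x + z ≤ y → x ≤ y - z
  x+z≤y⇒x≤y-z {x} {y} {z} le =
    +-cancelʳ-≤ z (≤-trans le (≤-reflexive (sym (x-y+y≈x z y))))

  x≤y+z⇒x-z≤y : ∀ {x y z} → x ≤ y + z → x - z ≤ y
  x≤y+z⇒x-z≤y {x} {y} {z} le =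
    +-cancelʳ-≤ z (≤-trans (≤-reflexive (x-y+y≈x z x)) le)

  x+y<z⇒y<z-x : ∀ {x y z} → x + y < z → y < z - x
  x+y<z⇒y<z-x {x} {y} {z} lt = ≰⇒> λ z-x≤y → <⇒≱ lt (begin
    z          ≈⟨ x-y+y≈x x z ⟨
    z - x + x  ≤⟨ +-monoˡ-≤ x z-x≤y ⟩
    y + x      ≈⟨ +-comm y x ⟩
    x + y      ∎)

  x<y⇒0<y-x : ∀ {x y} → x < y → 0# < y - x
  x<y⇒0<y-x {x} x<y = x+y<z⇒y<z-x (≤-<-trans (≤-reflexive (+-identityʳ x)) x<y)

  x≤x+y : ∀ x {y} → 0# ≤ y → x ≤ x + y
  x≤x+y x {y} 0≤y = begin
    x       ≈⟨ +-identityʳ x ⟨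
    x + 0#  ≤⟨ +-monoʳ-≤ x 0≤y ⟩
    x + y   ∎

  +-nonNegative : ∀ {x y} → 0# ≤ x → 0# ≤ y → 0# ≤ x + y
  +-nonNegative {x} 0≤x 0≤y = ≤-trans 0≤x (x≤x+y x 0≤y)

  *-monoˡ-≤ : ∀ {c x y} → 0# ≤ c → x ≤ y → c * x ≤ c * y
  *-monoˡ-≤ {c} {x} {y} 0≤c x≤y = begin
    c * x                ≤⟨ x≤x+y _ (*-nonNegative 0≤c (x≤y⇒0≤y-x x≤y)) ⟩
    c * x + c * (y - x)  ≈⟨ distribˡ c x (y - x) ⟨
    c * (x + (y - x))    ≈⟨ *-congˡ (trans (+-comm x (y - x)) (x-y+y≈x x y)) ⟩
    c * y                ∎

  *-monoʳ-≤ : ∀ {c x y} → 0# ≤ c → x ≤ y → x * c ≤ y * c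
  *-monoʳ-≤ {c} {x} {y} 0≤c x≤y = begin
    x * c  ≈⟨ *-comm x c ⟩
    c * x  ≤⟨ *-monoˡ-≤ 0≤c x≤y ⟩
    c * y  ≈⟨ *-comm c y ⟩
    y * c  ∎

  0≤1 : 0# ≤ 1#
  0≤1 with total 0# 1#
  ... | inj₁ le = le
  ... | inj₂ 1≤0 = begin
    0#                 ≤⟨ *-nonNegative 0≤-1 0≤-1 ⟩
    - 1# * - 1#        ≈⟨ -1*x≈-x (- 1#) ⟩
    - - 1#             ≈⟨ -‿involutive 1# ⟩
    1#                 ∎
    where
    0≤-1 : 0# ≤ - 1#
    0≤-1 = ≤-trans (x≤y⇒0≤y-x 1≤0) (≤-reflexive (+-identityˡ (- 1#)))

  0<1 : 0# < 1#
  0<1 = 0≤1 , 0≉1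

  0<x⇒x≉0 : ∀ {x} → 0# < x → ¬ x ≈ 0#
  0<x⇒x≉0 (_ , 0≉x) x≈0 = 0≉x (sym x≈0)

  ⁻¹-nonNegative : ∀ {x} → 0# < x → 0# ≤ x ⁻¹
  ⁻¹-nonNegative {x} 0<x = decidable-stable (0# ≤? x ⁻¹) λ 0≰x⁻¹ →
    <⇒≱ 0<1 (begin
      1#        ≈⟨ ⁻¹-inverseʳ x (0<x⇒x≉0 0<x) ⟨
      x * x ⁻¹  ≤⟨ *-monoˡ-≤ (<⇒≤ 0<x) (<⇒≤ (≰⇒> 0≰x⁻¹)) ⟩
      x * 0#    ≈⟨ zeroʳ x ⟩
      0#        ∎)

  x≤y*z⇒x*z⁻¹≤y : ∀ {x y z} → 0# < z → x ≤ y * z → x * z ⁻¹ ≤ y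
  x≤y*z⇒x*z⁻¹≤y {x} {y} {z} 0<z le = begin
    x * z ⁻¹        ≤⟨ *-monoʳ-≤ (⁻¹-nonNegative 0<z) le ⟩
    (y * z) * z ⁻¹  ≈⟨ *-assoc y z (z ⁻¹) ⟩
    y * (z * z ⁻¹)  ≈⟨ *-congˡ (⁻¹-inverseʳ z (0<x⇒x≉0 0<z)) ⟩
    y * 1#          ≈⟨ *-identityʳ y ⟩
    y               ∎

  x*z≤y⇒x≤y*z⁻¹ : ∀ {x y z} → 0# < z → x * z ≤ y → x ≤ y * z ⁻¹
  x*z≤y⇒x≤y*z⁻¹ {x} {y} {z} 0<z le = begin
    x               ≈⟨ *-identityʳ x ⟨
    x * 1#          ≈⟨ *-congˡ (⁻¹-inverseʳ z (0<x⇒x≉0 0<z)) ⟨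
    x * (z * z ⁻¹)  ≈⟨ *-assoc x z (z ⁻¹) ⟨
    (x * z) * z ⁻¹  ≤⟨ *-monoʳ-≤ (⁻¹-nonNegative 0<z) le ⟩
    y * z ⁻¹        ∎

  *-positive : ∀ {x y} → 0# < x → 0# < y → 0# < x * y
  *-positive {x} {y} 0<x 0<y = ≰⇒> λ xy≤0 → <⇒≱ 0<x (begin
    x               ≤⟨ x*z≤y⇒x≤y*z⁻¹ 0<y xy≤0 ⟩
    0# * y ⁻¹       ≈⟨ zeroˡ (y ⁻¹) ⟩
    0#              ∎)

  -- The witness is the midpoint; halving makes sense because 1 + 1 is positive.
  dense : ∀ {x y} → x < y → ∃[ z ] (x < z × z < y)
  dense {x} {y} x<y = m , ≰⇒> m≰x , ≰⇒> y≰m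
    where
    2# m : Carrier
    2# = 1# + 1#
    m = (x + y) * 2# ⁻¹

    2≉0 : ¬ 2# ≈ 0#
    2≉0 2≈0 = <⇒≱ 0<1 (≤-trans (x≤x+y 1# 0≤1) (≤-reflexive 2≈0))

    m+m≈x+y : m + m ≈ x + y
    m+m≈x+y = begin-equality
      m + m                        ≈⟨ distribˡ (x + y) (2# ⁻¹) (2# ⁻¹) ⟨
      (x + y) * (2# ⁻¹ + 2# ⁻¹)    ≈⟨ *-congˡ (+-cong (*-identityˡ _) (*-identityˡ _)) ⟨
      (x + y) * (1# * 2# ⁻¹ + 1# * 2# ⁻¹)  ≈⟨ *-congˡ (distribʳ (2# ⁻¹) 1# 1#) ⟨
      (x + y) * (2# * 2# ⁻¹)       ≈⟨ *-congˡ (⁻¹-inverseʳ 2# 2≉0) ⟩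
      (x + y) * 1#                 ≈⟨ *-identityʳ (x + y) ⟩
      x + y                        ∎

    m≰x : ¬ m ≤ x
    m≰x m≤x = <⇒≱ x<y (+-cancelʳ-≤ x (begin
      y + x  ≈⟨ +-comm y x ⟩
      x + y  ≈⟨ m+m≈x+y ⟨
      m + m  ≤⟨ +-mono-≤ m≤x m≤x ⟩
      x + x  ∎))

    y≰m : ¬ y ≤ m
    y≰m y≤m = <⇒≱ x<y (+-cancelʳ-≤ y (begin
      y + y  ≤⟨ +-mono-≤ y≤m y≤m ⟩
      m + m  ≈⟨ m+m≈x+y ⟩
      x + y  ∎))

  fromℕ-nonNegative : ∀ k → 0# ≤ fromℕ k
  fromℕ-nonNegative zero    = ≤-refl
  fromℕ-nonNegative (suc k) = +-nonNegative 0≤1 (fromℕ-nonNegative k)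

  fromℕ-mono-≤ : ∀ {j k} → j ℕ.≤ k → fromℕ j ≤ fromℕ k
  fromℕ-mono-≤ {k = k} z≤n = fromℕ-nonNegative k
  fromℕ-mono-≤ (s≤s j≤k) = +-monoʳ-≤ 1# (fromℕ-mono-≤ j≤k)

  fromℕ-positive : ∀ {k} → 0 ℕ.< k → 0# < fromℕ k
  fromℕ-positive {suc k} _ = ≰⇒> λ le →
    <⇒≱ 0<1 (≤-trans (x≤x+y 1# (fromℕ-nonNegative k)) le)

  indicator-nonNegative : ∀ {ℓ} {P : Set ℓ} (P? : Dec P) → 0# ≤ indicator P?
  indicator-nonNegative (yes _) = 0≤1
  indicator-nonNegative (no  _) = ≤-refl

  sum-mono-≤ : ∀ {n} {f g : Fin n → Carrier} → (∀ i → f i ≤ g i) → sum f ≤ sum g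
  sum-mono-≤ {zero}  f≤g = ≤-refl
  sum-mono-≤ {suc n} f≤g = +-mono-≤ (f≤g Fin.zero) (sum-mono-≤ (f≤g ∘ Fin.suc))

  sum-nonNegative : ∀ {n} {f : Fin n → Carrier} → (∀ i → 0# ≤ f i) → 0# ≤ sum f
  sum-nonNegative {zero}  0≤f = ≤-refl
  sum-nonNegative {suc n} 0≤f =
    +-nonNegative (0≤f Fin.zero) (sum-nonNegative (0≤f ∘ Fin.suc))

  term≤sum : ∀ {n} {f : Fin n → Carrier} → (∀ i → 0# ≤ f i) → ∀ i → f i ≤ sum f
  term≤sum 0≤f Fin.zero = x≤x+y _ (sum-nonNegative (0≤f ∘ Fin.suc))
  term≤sum {f = f} 0≤f (Fin.suc i) = begin
    f (Fin.suc i)                     ≤⟨ term≤sum (0≤f ∘ Fin.suc) i ⟩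
    sum (f ∘ Fin.suc)                 ≈⟨ +-identityˡ _ ⟨
    0# + sum (f ∘ Fin.suc)            ≤⟨ +-monoˡ-≤ _ (0≤f Fin.zero) ⟩
    f Fin.zero + sum (f ∘ Fin.suc)    ∎

-- The Lebesgue measure of an interval

module IntervalMeasure (ℝ : CompleteOrderedField) where
  open CompleteOrderedField ℝ
  open OrderedField ℝ
  open Lebesgue ℝ
  open PartialOrderReasoning poset
  open CommutativeSemigroupProperties
    (Bundles.CommutativeMonoid.commutativeSemigroup +-commutativeMonoid)
    using (interchange; x∙yz≈y∙xz)
  open Sum +-commutativeMonoid using (∑-distrib-+; sum-replicate-zero; sum-cong-≋)
  open NaturalMin totalOrder
    using (x⊓y≤x; x⊓y≤y; ⊓-glb; ⊓-sel; ⊓-monoʳ-≤) renaming (_⊓_ to min)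
  open NaturalMax totalOrder using (x≤x⊔y; x≤y⊔x; ⊔-lub; ⊔-monoʳ-≤)

  <-min : ∀ {x y z} → x < y → x < z → x < min y z
  <-min {x} {y} {z} x<y x<z with ⊓-sel y z
  ... | inj₁ eq = ≰⇒> λ le → <⇒≱ x<y (≤-trans (≤-reflexive (sym eq)) le)
  ... | inj₂ eq = ≰⇒> λ le → <⇒≱ x<z (≤-trans (≤-reflexive (sym eq)) le)

  -- For l ≤ r, the point of [ l ⋯ r ] nearest to x.  The part of this interval
  -- that lies below x has length clamp l r x - l, so the growth of clamp l r
  -- from a to x is the length which the interval contributes to [ a ⋯ x ].
  clamp : Carrier → Carrier → Carrier → Carrier
  clamp l r x = max l (min r x)

  clamp-mono : ∀ l r {x y} → x ≤ y → clamp l r x ≤ clamp l r y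
  clamp-mono l r x≤y = ⊔-monoʳ-≤ l (⊓-monoʳ-≤ r x≤y)

  clamp-inside : ∀ {l r x} → l ≤ x → x ≤ r → clamp l r x ≈ x
  clamp-inside {l} {r} {x} l≤x x≤r = antisym
    (⊔-lub l≤x (x⊓y≤y r x))
    (≤-trans (⊓-glb x≤r ≤-refl) (x≤y⊔x l (min r x)))

  -- One summand that grows by at least y - x suffices for the whole sum to do
  -- so, when no summand decreases.
  sum-growth : ∀ {n} {f g : Fin n → Carrier} {x y} → (∀ i → f i ≤ g i) →
               ∀ i → y + f i ≤ x + g i → y + sum f ≤ x + sum g
  sum-growth {suc n} {f} {g} {x} {y} f≤g Fin.zero le = begin
    y + (f Fin.zero + sum (f ∘ Fin.suc))  ≈⟨ +-assoc y _ _ ⟨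
    (y + f Fin.zero) + sum (f ∘ Fin.suc)  ≤⟨ +-mono-≤ le (sum-mono-≤ (f≤g ∘ Fin.suc)) ⟩
    (x + g Fin.zero) + sum (g ∘ Fin.suc)  ≈⟨ +-assoc x _ _ ⟩
    x + (g Fin.zero + sum (g ∘ Fin.suc))  ∎
  sum-growth {suc n} {f} {g} {x} {y} f≤g (Fin.suc i) le = begin
    y + (f Fin.zero + sum (f ∘ Fin.suc))  ≈⟨ x∙yz≈y∙xz y _ _ ⟩
    f Fin.zero + (y + sum (f ∘ Fin.suc))
      ≤⟨ +-mono-≤ (f≤g Fin.zero) (sum-growth (f≤g ∘ Fin.suc) i le) ⟩
    g Fin.zero + (x + sum (g ∘ Fin.suc))  ≈⟨ x∙yz≈y∙xz x _ _ ⟨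
    x + (g Fin.zero + sum (g ∘ Fin.suc))  ∎

  -- A countable cover of the half-open interval [a, b) by the open intervals
  -- (l k, r k), of total length at most s.
  module _ {a b s : Carrier} (l r : ℕ → Carrier) (a≤b : a ≤ b)
           (l≤r : ∀ k → l k ≤ r k)
           (covered : ∀ x → a ≤ x → x < b → ∃[ k ] (l k < x × x < r k))
           (length≤s : ∀ N → sum {N} (λ k → r (Fin.toℕ k) - l (Fin.toℕ k)) ≤ s)
    where

    below : ℕ → Carrier → Carrier
    below N x = sum {N} λ k → clamp (l (Fin.toℕ k)) (r (Fin.toℕ k)) x

    below-growth : ∀ {N k x y} → k ℕ.< N → l k ≤ x → x ≤ y → y ≤ r k →
                   y + below N x ≤ x + below N y
    below-growth {N} {k} {x} {y} k<N l≤x x≤y y≤r =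
      sum-growth {N} (λ i → clamp-mono _ _ x≤y) (Fin.fromℕ< k<N)
        (≡.subst (λ j → y + clamp (l j) (r j) x ≤ x + clamp (l j) (r j) y)
                 (≡.sym (Fin.toℕ-fromℕ< k<N)) grows)
      where
      grows : y + clamp (l k) (r k) x ≤ x + clamp (l k) (r k) y
      grows = begin
        y + clamp (l k) (r k) x  ≈⟨ +-congˡ (clamp-inside l≤x (≤-trans x≤y y≤r)) ⟩
        y + x                    ≈⟨ +-comm y x ⟩
        x + y                    ≈⟨ +-congˡ (clamp-inside (≤-trans l≤x x≤y) y≤r) ⟨
        x + clamp (l k) (r k) y  ∎

    -- The points x for which the length x - a of [ a ⋯ x ] is accounted for by
    -- the parts of finitely many covering intervals inside [ a ⋯ x ].  Asking
    -- this for every M past a bound N, rather than for one M, allows two bounds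
    -- to be combined by their maximum.
    Measured : Pred Carrier _
    Measured x = a ≤ x × x ≤ b ×
      ∃[ N ] (∀ M → N ℕ.≤ M → x + below M a ≤ a + below M x)

    measured-start : Measured a
    measured-start = ≤-refl , a≤b , 0 , λ _ _ → ≤-refl

    -- Between x and y, both in the closure of the k-th interval, that interval
    -- alone contributes y - x.
    measured-step : ∀ {x y} → Measured x → ∀ k → l k ≤ x → x ≤ y →
                    y ≤ b → y ≤ r k → Measured y
    measured-step {x} {y} (a≤x , _ , N , short) k l≤x x≤y y≤b y≤r =
      ≤-trans a≤x x≤y , y≤b , N ℕ.⊔ suc k , λ M N⊔k<M →
        +-cancelʳ-≤ (x + below M x) (begin
          (y + below M a) + (x + below M x)  ≈⟨ +-congˡ (+-comm x _) ⟩
          (y + below M a) + (below M x + x)  ≈⟨ interchange y _ _ x ⟩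
          (y + below M x) + (below M a + x)  ≈⟨ +-congˡ (+-comm _ x) ⟩
          (y + below M x) + (x + below M a)
            ≤⟨ +-mono-≤
                 (below-growth (ℕ.≤-trans (ℕ.m≤n⊔m N (suc k)) N⊔k<M) l≤x x≤y y≤r)
                 (short M (ℕ.≤-trans (ℕ.m≤m⊔n N (suc k)) N⊔k<M)) ⟩
          (x + below M y) + (a + below M x)  ≈⟨ +-comm _ _ ⟩
          (a + below M x) + (x + below M y)  ≈⟨ interchange a _ x _ ⟩
          (a + x) + (below M x + below M y)  ≈⟨ +-congˡ (+-comm _ _) ⟩
          (a + x) + (below M y + below M x)  ≈⟨ interchange a x _ _ ⟩
          (a + below M y) + (x + below M x)  ∎)

    -- Each covering interval contributes at most its own length: clamping to it
    -- gives at least l k at a and at most r k at x.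
    measured⇒≤ : ∀ x → Measured x → x ≤ a + s
    measured⇒≤ x (_ , _ , N , short) = +-cancelʳ-≤ (sum L) (begin
      x + sum L                        ≤⟨ +-monoʳ-≤ x (sum-mono-≤ {N} λ k → x≤x⊔y _ _) ⟩
      x + below N a                    ≤⟨ short N ℕ.≤-refl ⟩
      a + below N x                    ≤⟨ +-monoʳ-≤ a (sum-mono-≤ {N} λ k → ⊔-lub (l≤r _) (x⊓y≤x _ _)) ⟩
      a + sum R                        ≈⟨ +-congˡ (sum-cong-≋ {N} λ k → x-y+y≈x (L k) (R k)) ⟨
      a + sum (λ k → (R k - L k) + L k) ≈⟨ +-congˡ (∑-distrib-+ {N} (λ k → R k - L k) L) ⟩
      a + (sum (λ k → R k - L k) + sum L) ≈⟨ +-assoc a _ _ ⟨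
      (a + sum (λ k → R k - L k)) + sum L ≤⟨ +-monoˡ-≤ _ (+-monoʳ-≤ a (length≤s N)) ⟩
      (a + s) + sum L                  ∎)
      where
      L R : Fin N → Carrier
      L k = l (Fin.toℕ k)
      R k = r (Fin.toℕ k)

    -- Let p be the supremum of the measured points.  If p < b, then p lies in
    -- some (l k, r k); as l k is no upper bound, some measured x exceeds l k,
    -- and from there measured-step reaches y = min b (r k) > p, a
    -- contradiction.  So b ≤ p, while all measured points are at most a + s.
    interval-cover : b ≤ a + s
    interval-cover with supremum Measured (a , measured-start) (a + s , measured⇒≤)
    ... | p , upper , lowest = ≤-trans b≤p (lowest (a + s) measured⇒≤)
      where
      b≤p : b ≤ p
      b≤p = decidable-stable (b ≤? p) λ b≰p →
        let p<b = ≰⇒> b≰p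
            k , l<p , p<r = covered p (upper a measured-start) p<b
            y = min b (r k)
            p<y = <-min p<b p<r
        in <⇒≱ l<p (lowest (l k) λ x mx → decidable-stable (x ≤? l k) λ x≰l →
             <⇒≱ p<y (upper y
               (measured-step mx k (<⇒≤ (≰⇒> x≰l)) (≤-trans (upper x mx) (<⇒≤ p<y))
                              (x⊓y≤x b (r k)) (x⊓y≤y b (r k)))))

  Open : Carrier → Carrier → Pred Carrier _
  Open a b t = a < t × t < b

  -- The interval covers itself, which bounds its measure from above.  From
  -- below: a cover of (a, b) covers [c, b) whenever a < c, and if its length s
  -- were less than b - a, there would be such a c with c + s < b.
  open-measure : ∀ {a b} → a ≤ b → IsOuterMeasure (Open a b) (b - a)
  open-measure {a} {b} a≤b = lower , λ _ below → below (b - a) cover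
    where
    lower : IsLowerBound (CoverableBy (Open a b)) (b - a)
    lower s (l , r , l≤r , covered , length≤s) = x≤y+z⇒x-z≤y
      (decidable-stable (b ≤? s + a) λ b≰s+a →
        let d , s+a<d , d<b = dense (≰⇒> b≰s+a)
            c = d - s
            a<c = x+y<z⇒y<z-x s+a<d
        in <⇒≱ d<b (begin
          b          ≤⟨ interval-cover l r (d-s≤b d<b) l≤r
                          (λ x c≤x x<b → covered x (<-≤-trans a<c c≤x , x<b))
                          length≤s ⟩
          d - s + s  ≈⟨ x-y+y≈x s d ⟩
          d          ∎))
      where
      -- The nonempty range demanded by interval-cover; s is nonnegative
      -- because it bounds the empty sum.
      d-s≤b : ∀ {d} → d < b → d - s ≤ b
      d-s≤b d<b = x≤y+z⇒x-z≤y (≤-trans (<⇒≤ d<b) (x≤x+y b (length≤s 0)))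

    -- (a, b) followed by degenerate intervals.
    L R : ℕ → Carrier
    L _       = a
    R zero    = b
    R (suc _) = a

    cover : CoverableBy (Open a b) (b - a)
    cover = L , R , (λ { zero → a≤b ; (suc _) → ≤-refl }) , (λ _ x∈ → 0 , x∈) , total-length
      where
      total-length : ∀ N → sum {N} (λ k → R (Fin.toℕ k) - L (Fin.toℕ k)) ≤ b - a
      total-length zero    = x≤y⇒0≤y-x a≤b
      total-length (suc N) = ≤-reflexive (trans
        (+-congˡ (trans (sum-cong-≋ {N} λ _ → -‿inverseʳ a) (sum-replicate-zero N)))
        (+-identityʳ (b - a)))

  empty-measure : ∀ {A} → (∀ x → ¬ A x) → IsOuterMeasure A 0#
  empty-measure empty =
    (λ s (_ , _ , _ , _ , length≤s) → length≤s 0) ,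
    λ _ below → below 0# ((λ _ → 0#) , (λ _ → 0#) , (λ _ → ≤-refl) ,
      (λ x x∈ → contradiction x∈ (empty x)) ,
      λ N → ≤-reflexive (trans (sum-cong-≋ {N} λ _ → -‿inverseʳ 0#) (sum-replicate-zero N)))

  open-isOpen : ∀ a b → IsOpen (Open a b)
  open-isOpen a b x (a<x , x<b) =
    min (x - a) (b - x) ,
    <-min (x<y⇒0<y-x a<x) (x<y⇒0<y-x x<b) ,
    λ y x-ε<y y<x+ε →
      ≤-<-trans (x+z≤y⇒x≤y-z (begin
        a + min (x - a) (b - x)  ≤⟨ +-monoʳ-≤ a (x⊓y≤x _ _) ⟩
        a + (x - a)              ≈⟨ +-comm a (x - a) ⟩
        x - a + a                ≈⟨ x-y+y≈x a x ⟩
        x                        ∎)) x-ε<y ,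
      <-≤-trans y<x+ε (begin
        x + min (x - a) (b - x)  ≤⟨ +-monoʳ-≤ x (x⊓y≤y _ _) ⟩
        x + (b - x)              ≈⟨ +-comm x (b - x) ⟩
        b - x + x                ≈⟨ x-y+y≈x x b ⟩
        b                        ∎)

  open-measurable : ∀ a b → Measurable (Open a b)
  open-measurable a b ε 0<ε = Open a b , open-isOpen a b , (λ _ x∈ → x∈) ,
    0# , empty-measure (λ _ (x∈ , x∉) → x∉ x∈) , <⇒≤ 0<ε

-- Trees and their clusters

module Trees {n : ℕ} where

  -- The form in which inductions on the tree use that no label is repeated.
  DisjointChildren : Tree n → Set
  DisjointChildren (leaf _)   = ⊤
  DisjointChildren (node l r) =
    (∀ x → x ∈ root l → x ∉ root r) × DisjointChildren l × DisjointChildren r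

  root⇒leaf : ∀ (t : Tree n) {x} → x ∈ root t → x ∈ˡ leaves t
  root⇒leaf (leaf y)   x∈ = here (x∈⁅y⁆⇒x≡y y x∈)
  root⇒leaf (node l r) x∈ with x∈p∪q⁻ (root l) (root r) x∈
  ... | inj₁ x∈l = ∈-++⁺ˡ (root⇒leaf l x∈l)
  ... | inj₂ x∈r = ∈-++⁺ʳ (leaves l) (root⇒leaf r x∈r)

  leaf⇒root : ∀ (t : Tree n) {x} → x ∈ˡ leaves t → x ∈ root t
  leaf⇒root (leaf y)   (here ≡.refl) = x∈⁅x⁆ y
  leaf⇒root (node l r) x∈ with ∈-++⁻ (leaves l) x∈
  ... | inj₁ x∈l = x∈p∪q⁺ (inj₁ (leaf⇒root l x∈l))
  ... | inj₂ x∈r = x∈p∪q⁺ (inj₂ (leaf⇒root r x∈r))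

  unique-++⁻ : ∀ (xs : List (Fin n)) {ys} → Unique (xs ++ ys) →
               Unique xs × Unique ys × (∀ {x} → x ∈ˡ xs → ¬ x ∈ˡ ys)
  unique-++⁻ []       u        = [] , u , λ ()
  unique-++⁻ (x ∷ xs) (x∉ ∷ u) with unique-++⁻ xs u
  ... | uˣ , uʸ , disjoint =
    All.++⁻ˡ xs x∉ ∷ uˣ , uʸ , λ where
      (here ≡.refl) x∈ys → All.lookup (All.++⁻ʳ xs x∉) x∈ys ≡.refl
      (there x∈)  x∈ys → disjoint x∈ x∈ys

  unique⇒disjoint : ∀ (t : Tree n) → Unique (leaves t) → DisjointChildren t
  unique⇒disjoint (leaf _)   _ = _
  unique⇒disjoint (node l r) u with unique-++⁻ (leaves l) u
  ... | uˡ , uʳ , disjoint =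
    (λ x x∈l x∈r → disjoint (root⇒leaf l x∈l) (root⇒leaf r x∈r)) ,
    unique⇒disjoint l uˡ , unique⇒disjoint r uʳ

  hierarchy-disjoint : (T : Hierarchy n) → DisjointChildren (Hierarchy.tree T)
  hierarchy-disjoint T = unique⇒disjoint tree
    (Permutation.Unique-resp-↭ (≡.setoid (Fin n)) (↭⇒↭ₛ (↭-sym spans)) (allFin⁺ n))
    where open Hierarchy T

  hierarchy-full : (T : Hierarchy n) → ∀ x → x ∈ root (Hierarchy.tree T)
  hierarchy-full T x = leaf⇒root tree (∈-resp-↭ (↭-sym spans) (∈-allFin x))
    where open Hierarchy T

  root-nonempty : ∀ (t : Tree n) → ∃[ x ] x ∈ root t
  root-nonempty (leaf x)   = x , x∈⁅x⁆ x
  root-nonempty (node l r) =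
    Product.map₂ (p⊆p∪q (root r)) (root-nonempty l)

  -- The three branches in the definition of lca.
  data LcaView (l r : Tree n) (x y : Fin n) : Subset n → Set where
    left  : x ∈ root l → y ∈ root l → LcaView l r x y (lca l x y)
    right : x ∈ root r → y ∈ root r → LcaView l r x y (lca r x y)
    split : ¬ (x ∈ root l × y ∈ root l) → ¬ (x ∈ root r × y ∈ root r) →
            LcaView l r x y (root (node l r))

  lcaView : ∀ (l r : Tree n) x y → LcaView l r x y (lca (node l r) x y)
  lcaView l r x y =
    if-elim (x ∈? root l ×-dec y ∈? root l) (LcaView l r x y)
      (λ (x∈l , y∈l) → left x∈l y∈l)
      λ ¬l → if-elim (x ∈? root r ×-dec y ∈? root r) (LcaView l r x y)
        (λ (x∈r , y∈r) → right x∈r y∈r)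
        λ ¬r → split ¬l ¬r

  lca∈clusters : ∀ (t : Tree n) x y → lca t x y ∈ˡ clusters t
  lca∈clusters (leaf _)   x y = here ≡.refl
  lca∈clusters (node l r) x y with lca (node l r) x y | lcaView l r x y
  ... | _ | left  _ _ = there (∈-++⁺ˡ (lca∈clusters l x y))
  ... | _ | right _ _ = there (∈-++⁺ʳ (clusters l) (lca∈clusters r x y))
  ... | _ | split _ _ = here ≡.refl

  ∈-lca : ∀ (t : Tree n) {x y} → x ∈ root t → y ∈ root t →
          x ∈ lca t x y × y ∈ lca t x y
  ∈-lca (leaf _)   x∈ y∈ = x∈ , y∈
  ∈-lca (node l r) {x} {y} x∈ y∈ with lca (node l r) x y | lcaView l r x y
  ... | _ | left  x∈l y∈l = ∈-lca l x∈l y∈l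
  ... | _ | right x∈r y∈r = ∈-lca r x∈r y∈r
  ... | _ | split _ _     = x∈ , y∈

  -- Two distinct vertices are what makes the diameter of an internal cluster
  -- positive.
  Proper : Tree n → Internal n → Set
  Proper t S = cluster ∈ˡ clusters t ×
    ∃[ x ] ∃[ y ] (x ∈ cluster × y ∈ cluster × x ≢ y)
    where open Internal S

  internals-proper : ∀ (t : Tree n) → DisjointChildren t → All (Proper t) (internals t)
  internals-proper (leaf _)     _ = []
  internals-proper t@(node l r) (disjoint , dˡ , dʳ) =
    (here ≡.refl , x , y , p⊆p∪q (root r) x∈l , q⊆p∪q (root l) (root r) y∈r ,
     λ x≡y → disjoint x x∈l (≡.subst (_∈ root r) (≡.sym x≡y) y∈r)) ∷
    All.++⁺ (All.map (Product.map₁ (there ∘ ∈-++⁺ˡ)) (internals-proper l dˡ))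
            (All.map (Product.map₁ (there ∘ ∈-++⁺ʳ (clusters l)))
                     (internals-proper r dʳ))
    where
    x = proj₁ (root-nonempty l)
    x∈l = proj₂ (root-nonempty l)
    y = proj₁ (root-nonempty r)
    y∈r = proj₂ (root-nonempty r)

-- Short walks in connected sets

module Paths {n : ℕ} (Adj : Rel (Fin n) 0ℓ) where

  Within : Subset n → Rel (Fin n) 0ℓ
  Within S a b = a ∈ S × b ∈ S × Adj a b

  -- The part of a walk after its last visit to x stays in S - x.  The walk is
  -- read from its end, where x is absent; the second alternative records the
  -- departure from x that is met first.
  last-visit : ∀ S x k {z y} → z ∈ S → y ≢ x → Walk (Within S) k z y →
    (z ≢ x × ∃[ j ] Walk (Within (S Subset.- x)) j z y) ⊎
    (∃[ z′ ] (z′ ∈ S Subset.- x × Adj x z′ × ∃[ j ] Walk (Within (S Subset.- x)) j z′ y))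
  last-visit S x zero    z∈ y≢x ≡.refl = inj₁ (y≢x , 0 , ≡.refl)
  last-visit S x (suc k) {z} z∈ y≢x (z′ , (_ , z′∈ , adj) , walk)
    with last-visit S x k z′∈ y≢x walk | z Fin.≟ x
  ... | inj₂ departure           | _        = inj₂ departure
  ... | inj₁ (z′≢x , j , walk′)  | yes ≡.refl =
    inj₂ (z′ , x∈p∧x≢y⇒x∈p-y z′∈ z′≢x , adj , j , walk′)
  ... | inj₁ (z′≢x , j , walk′)  | no z≢x   =
    inj₁ (z≢x , suc j , z′ ,
      (x∈p∧x≢y⇒x∈p-y z∈ z≢x , x∈p∧x≢y⇒x∈p-y z′∈ z′≢x , adj) , walk′)

  -- Removing the start from S after its last visit, recursively, produces a walk
  -- without repeated vertices, hence with fewer steps than S has elements.  The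
  -- number m bounds the depth of the recursion.
  short-walk : ∀ m S → ∣ S ∣ ℕ.< m → ∀ {x y} k → x ∈ S → Walk (Within S) k x y →
               ∃[ j ] (j ℕ.< ∣ S ∣ × Walk Adj j x y)
  short-walk (suc m) S (s≤s ∣S∣≤m) {x} {y} k x∈ walk with y Fin.≟ x
  ... | yes ≡.refl = 0 , ℕ.≤-trans (s≤s z≤n) (x∈p⇒∣p-x∣<∣p∣ x∈) , ≡.refl
  ... | no y≢x with last-visit S x k x∈ y≢x walk
  ...   | inj₁ (x≢x , _) = contradiction ≡.refl x≢x
  ...   | inj₂ (z , z∈ , adj , i , walk′)
    with short-walk m (S Subset.- x) (ℕ.≤-trans (x∈p⇒∣p-x∣<∣p∣ x∈) ∣S∣≤m) i z∈ walk′
  ...     | j , j< , walk″ =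
    suc j , ℕ.≤-trans (s≤s j<) (x∈p⇒∣p-x∣<∣p∣ x∈) , z , adj , walk″

-- Finite sums

module ListSums (ℝ : CompleteOrderedField) where
  open CompleteOrderedField ℝ
  open CommutativeSemigroupProperties
    (Bundles.CommutativeMonoid.commutativeSemigroup +-commutativeMonoid)
    using (interchange)

  indicator-yes : ∀ {ℓ} {P : Set ℓ} (P? : Dec P) → P → indicator P? ≡ 1#
  indicator-yes P? p rewrite dec-true P? p = ≡.refl

  indicator-no : ∀ {ℓ} {P : Set ℓ} (P? : Dec P) → ¬ P → indicator P? ≡ 0#
  indicator-no P? ¬p rewrite dec-false P? ¬p = ≡.refl

  module _ {A : Set} where

    Σˡ : (A → Carrier) → List A → Carrier
    Σˡ f xs = listSum (map f xs)

    Σˡ-cong : ∀ {f g} {xs : List A} → All (λ x → f x ≈ g x) xs → Σˡ f xs ≈ Σˡ g xs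
    Σˡ-cong []         = refl
    Σˡ-cong (eq ∷ eqs) = +-cong eq (Σˡ-cong eqs)

    Σˡ-distrib-+ : ∀ f g (xs : List A) →
                   Σˡ (λ x → f x + g x) xs ≈ Σˡ f xs + Σˡ g xs
    Σˡ-distrib-+ f g []       = sym (+-identityˡ 0#)
    Σˡ-distrib-+ f g (x ∷ xs) =
      trans (+-congˡ (Σˡ-distrib-+ f g xs)) (interchange (f x) (g x) _ _)

    *-distribˡ-Σˡ : ∀ c f (xs : List A) → c * Σˡ f xs ≈ Σˡ (λ x → c * f x) xs
    *-distribˡ-Σˡ c f []       = zeroʳ c
    *-distribˡ-Σˡ c f (x ∷ xs) =
      trans (distribˡ c (f x) _) (+-congˡ (*-distribˡ-Σˡ c f xs))

    Σˡ-++ : ∀ f (xs ys : List A) → Σˡ f (xs ++ ys) ≈ Σˡ f xs + Σˡ f ys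
    Σˡ-++ f []       ys = sym (+-identityˡ _)
    Σˡ-++ f (x ∷ xs) ys = trans (+-congˡ (Σˡ-++ f xs ys)) (sym (+-assoc (f x) _ _))

    sum-lookup : ∀ f (xs : List A) → sum (λ i → f (lookup xs i)) ≈ Σˡ f xs
    sum-lookup f []       = refl
    sum-lookup f (x ∷ xs) = +-congˡ (sum-lookup f xs)

    Σˡ-filter : ∀ {P : Pred A 0ℓ} (P? : U.Decidable P) f xs →
                Σˡ f (filter P? xs) ≈ Σˡ (λ x → f x * indicator (P? x)) xs
    Σˡ-filter P? f []       = refl
    Σˡ-filter P? f (x ∷ xs) with P? x
    ... | yes _ = +-cong (sym (*-identityʳ (f x))) (Σˡ-filter P? f xs)
    ... | no  _ = trans (Σˡ-filter P? f xs)
                    (sym (trans (+-congʳ (zeroʳ (f x))) (+-identityˡ _)))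

-- Distances, diameters and sizes of clusters

module Clusters {ℝ : CompleteOrderedField} {n : ℕ} (G : WeightedGraph ℝ n) where
  open WeightedGraph G
  open GraphHierarchies G
  open Trees {n}
  open Paths Adj

  dist-minimal : ∀ {x y} k → Walk Adj k x y → dist x y ℕ.≤ k
  dist-minimal {x} {y} =
    let k , walk = connected x y in
    proj₂ (proj₂ (least (λ k → walk? adj? k x y) k walk))

  dist-positive : ∀ {x y} → x ≢ y → 1 ℕ.≤ dist x y
  dist-positive {x} {y} x≢y = ℕ.n≢0⇒n>0 λ dist≡0 →
    x≢y (≡.subst (λ k → Walk Adj k x y) dist≡0 shortest)
    where
    shortest : Walk Adj (dist x y) x y
    shortest =
      let k , walk = connected x y in
      proj₁ (proj₂ (least (λ k → walk? adj? k x y) k walk))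

  maximum-upper : ∀ {m} (f : Fin m → ℕ) i → f i ℕ.≤ maximum f
  maximum-upper f Fin.zero    = ℕ.m≤m⊔n _ _
  maximum-upper f (Fin.suc i) =
    ℕ.≤-trans (maximum-upper (f ∘ Fin.suc) i) (ℕ.m≤n⊔m (f Fin.zero) _)

  maximum-least : ∀ {m} (f : Fin m → ℕ) {k} → (∀ i → f i ℕ.≤ k) → maximum f ℕ.≤ k
  maximum-least {zero}  f f≤k = z≤n
  maximum-least {suc m} f f≤k =
    ℕ.⊔-lub (f≤k Fin.zero) (maximum-least (f ∘ Fin.suc) (f≤k ∘ Fin.suc))

  dist≤diam : ∀ {S x y} → x ∈ S → y ∈ S → dist x y ℕ.≤ diam S
  dist≤diam {S} {x} {y} x∈ y∈ = ℕ.≤-trans entry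
    (ℕ.≤-trans (maximum-upper _ y) (maximum-upper _ x))
    where
    entry : dist x y ℕ.≤ (if does (x ∈? S ×-dec y ∈? S) then dist x y else 0)
    entry rewrite dec-true (x ∈? S ×-dec y ∈? S) (x∈ , y∈) = ℕ.≤-refl

  diam-least : ∀ S {k} → (∀ x y → x ∈ S → y ∈ S → dist x y ℕ.≤ k) → diam S ℕ.≤ k
  diam-least S {k} dist≤k = maximum-least _ λ x → maximum-least _ λ y →
    if-elim (x ∈? S ×-dec y ∈? S) (ℕ._≤ k)
      (λ (x∈ , y∈) → dist≤k x y x∈ y∈) (λ _ → z≤n)

  connected⇒dist≤size-1 : ∀ {S x y} → InducesConnected S → x ∈ S → y ∈ S →
                        dist x y ℕ.≤ ∣ S ∣ ∸ 1
  connected⇒dist≤size-1 {S} {x} {y} conn x∈ y∈ with conn x y x∈ y∈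
  ... | k , walk with short-walk _ S ℕ.≤-refl k x∈ walk
  ...   | j , j<∣S∣ , walk′ =
    ℕ.≤-trans (dist-minimal j walk′) (ℕ.∸-monoˡ-≤ 1 j<∣S∣)

  -- Feasibility of h for OPTcard: the lca of x and y is a connected cluster
  -- which contains both.
  h-dominates : (T : Hierarchy n) → IsConnected T → ∀ x y → dist x y ℕ.≤ h T x y
  h-dominates T conn x y = if-elim (x Fin.≟ y) (dist x y ℕ.≤_)
    (λ x≡y → dist-minimal 0 x≡y)
    (λ _ → connected⇒dist≤size-1 (All.lookup conn (lca∈clusters tree x y)) x∈ y∈)
    where
    open Hierarchy T
    x∈ = proj₁ (∈-lca tree (hierarchy-full T x) (hierarchy-full T y))
    y∈ = proj₂ (∈-lca tree (hierarchy-full T x) (hierarchy-full T y))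

  Δ-bounds : (T : Hierarchy n) → IsConnected T →
    All (λ S → 1 ℕ.≤ Δ S × Δ S ℕ.≤ ∣ Internal.cluster S ∣ ∸ 1)
        (internals (Hierarchy.tree T))
  Δ-bounds T conn = All.map bounds (internals-proper tree (hierarchy-disjoint T))
    where
    open Hierarchy T
    bounds : ∀ {S} → Proper tree S → 1 ℕ.≤ Δ S × Δ S ℕ.≤ ∣ Internal.cluster S ∣ ∸ 1
    bounds (S∈ , x , y , x∈ , y∈ , x≢y) =
      ℕ.≤-trans (dist-positive x≢y) (dist≤diam x∈ y∈) ,
      diam-least _ λ _ _ → connected⇒dist≤size-1 (All.lookup conn S∈)

-- Decomposition of edge sums over the clusters of a hierarchy

module EdgeSums {ℝ : CompleteOrderedField} {n : ℕ} (G : WeightedGraph ℝ n) where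
  open CompleteOrderedField ℝ
  open OrderedField ℝ
  open ListSums ℝ
  open WeightedGraph G
  open GraphHierarchies G
  open Trees {n}
  open Clusters G
  open Sum +-commutativeMonoid using (∑-distrib-+; sum-replicate-zero; sum-cong-≋)
  open SemiringSum semiring using (*-distribˡ-sum)
  open CommutativeSemigroupProperties
    (Bundles.CommutativeMonoid.commutativeSemigroup *-commutativeMonoid)
    using () renaming (x∙yz≈y∙xz to x*yz≈y*xz)
  open PartialOrderReasoning poset

  private
    edge? : ∀ x y → Dec (x Fin.< y × Adj x y)
    edge? x y = x Fin.<? y ×-dec adj? x y

  edgeSum-cong : ∀ {f g} → (∀ x y → Adj x y → f x y ≈ g x y) → edgeSum f ≈ edgeSum g
  edgeSum-cong {f} {g} f≈g = sum-cong-≋ λ x → sum-cong-≋ λ y →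
    if-elim (edge? x y) {1#} {0#} (λ i → i * (w x y * f x y) ≈ i * (w x y * g x y))
      (λ (_ , adj) → *-congˡ (*-congˡ (f≈g x y adj)))
      (λ _ → trans (zeroˡ _) (sym (zeroˡ _)))

  edgeSum-0 : edgeSum (λ _ _ → 0#) ≈ 0#
  edgeSum-0 = trans
    (sum-cong-≋ {n} λ x → trans
      (sum-cong-≋ {n} λ y → trans (*-congˡ (zeroʳ (w x y))) (zeroʳ _))
      (sum-replicate-zero n))
    (sum-replicate-zero n)

  edgeSum-distrib-+ : ∀ f g →
    edgeSum (λ x y → f x y + g x y) ≈ edgeSum f + edgeSum g
  edgeSum-distrib-+ f g = trans
    (sum-cong-≋ {n} λ x → trans
      (sum-cong-≋ {n} λ y → trans (*-congˡ (distribˡ (w x y) _ _)) (distribˡ _ _ _))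
      (∑-distrib-+ {n} _ _))
    (∑-distrib-+ {n} _ _)

  *-distribˡ-edgeSum : ∀ c f → c * edgeSum f ≈ edgeSum (λ x y → c * f x y)
  *-distribˡ-edgeSum c f = trans (*-distribˡ-sum {n} c _)
    (sum-cong-≋ {n} λ x → trans (*-distribˡ-sum {n} c _)
      (sum-cong-≋ {n} λ y → trans (x*yz≈y*xz c _ _) (*-congˡ (x*yz≈y*xz c (w x y) _))))

  edgeSum-Σˡ : ∀ {A : Set} (f : A → Fin n → Fin n → Carrier) xs →
    edgeSum (λ x y → Σˡ (λ S → f S x y) xs) ≈ Σˡ (λ S → edgeSum (f S)) xs
  edgeSum-Σˡ f []       = edgeSum-0
  edgeSum-Σˡ f (S ∷ Ss) =
    trans (edgeSum-distrib-+ (f S) _) (+-congˡ (edgeSum-Σˡ f Ss))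

  edge-nonNegative : ∀ {f : Fin n → Fin n → Carrier} → (∀ x y → 0# ≤ f x y) →
                     ∀ x y → 0# ≤ indicator (edge? x y) * (w x y * f x y)
  edge-nonNegative {f} 0≤f x y =
    if-elim (edge? x y) (λ i → 0# ≤ i * (w x y * f x y))
      (λ (_ , adj) → *-nonNegative 0≤1 (*-nonNegative (<⇒≤ (w-pos adj)) (0≤f x y)))
      (λ _ → ≤-reflexive (sym (zeroˡ _)))

  edgeSum-nonNegative : ∀ {f : Fin n → Fin n → Carrier} → (∀ x y → 0# ≤ f x y) → 0# ≤ edgeSum f
  edgeSum-nonNegative {f} 0≤f =
    sum-nonNegative {n} λ x → sum-nonNegative {n} λ y → edge-nonNegative {f} 0≤f x y

  edgeSum-positive : ∀ {f : Fin n → Fin n → Carrier} {x y} → (∀ x y → 0# ≤ f x y) →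
                     x Fin.< y → Adj x y → 0# < f x y → 0# < edgeSum f
  edgeSum-positive {f} {x} {y} 0≤f x<y adj 0<f = begin-strict
    0#                                     <⟨ *-positive (w-pos adj) 0<f ⟩
    w x y * f x y                          ≈⟨ *-identityˡ _ ⟨
    1# * (w x y * f x y)                   ≡⟨ ≡.cong (_* _) (indicator-yes (edge? x y) (x<y , adj)) ⟨
    indicator (edge? x y) * (w x y * f x y) ≤⟨ term≤sum {n} (edge-nonNegative {f} 0≤f x) y ⟩
    sum (λ y → indicator (edge? x y) * (w x y * f x y))
      ≤⟨ term≤sum {n} (λ x → sum-nonNegative {n} (edge-nonNegative {f} 0≤f x)) x ⟩
    edgeSum f                              ∎

  split? : ∀ (S : Internal n) x y → let open Internal S in
    Dec ((x ∈ child⁰ × y ∈ child¹) ⊎ (x ∈ child¹ × y ∈ child⁰))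
  split? S x y = (x ∈? child⁰ ×-dec y ∈? child¹) ⊎-dec (x ∈? child¹ ×-dec y ∈? child⁰)
    where open Internal S

  module _ (f : Subset n → Carrier) where

    separation : Internal n → Fin n → Fin n → Carrier
    separation S x y = f (Internal.cluster S) * indicator (split? S x y)

    separation-yes : ∀ S x y → let open Internal S in
      (x ∈ child⁰ × y ∈ child¹) ⊎ (x ∈ child¹ × y ∈ child⁰) →
      separation S x y ≈ f cluster
    separation-yes S x y s rewrite indicator-yes (split? S x y) s = *-identityʳ _

    separation-no : ∀ S x y → let open Internal S in
      ¬ ((x ∈ child⁰ × y ∈ child¹) ⊎ (x ∈ child¹ × y ∈ child⁰)) →
      separation S x y ≈ 0#
    separation-no S x y s rewrite indicator-no (split? S x y) s = zeroʳ _

    total-separation : Tree n → Fin n → Fin n → Carrier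
    total-separation t x y = Σˡ (λ S → separation S x y) (internals t)

    total-separation-node : ∀ l r x y → total-separation (node l r) x y ≈
      separation (internal (root l) (root r)) x y +
        (total-separation l x y + total-separation r x y)
    total-separation-node l r x y =
      +-congˡ (Σˡ-++ (λ S → separation S x y) (internals l) (internals r))

    -- A cluster separates only vertices that it contains, and all clusters of t
    -- lie in its root.
    unseparated : ∀ (t : Tree n) {x y} → ¬ (x ∈ root t × y ∈ root t) →
                  total-separation t x y ≈ 0#
    unseparated (leaf _)   _ = refl
    unseparated (node l r) {x} {y} ¬xy = begin-equality
      total-separation (node l r) x y  ≈⟨ total-separation-node l r x y ⟩
      _ ≈⟨ +-cong (separation-no _ x y λ where
              (inj₁ (x∈l , y∈r)) → ¬xy (x∈p∪q⁺ (inj₁ x∈l) , x∈p∪q⁺ (inj₂ y∈r))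
              (inj₂ (x∈r , y∈l)) → ¬xy (x∈p∪q⁺ (inj₂ x∈r) , x∈p∪q⁺ (inj₁ y∈l)))
            (+-cong
              (unseparated l λ (x∈l , y∈l) → ¬xy (x∈p∪q⁺ (inj₁ x∈l) , x∈p∪q⁺ (inj₁ y∈l)))
              (unseparated r λ (x∈r , y∈r) → ¬xy (x∈p∪q⁺ (inj₂ x∈r) , x∈p∪q⁺ (inj₂ y∈r)))) ⟩
      0# + (0# + 0#)                   ≈⟨ trans (+-identityˡ _) (+-identityˡ _) ⟩
      0#                               ∎

    -- By disjointness, the children of exactly one cluster separate x from y: at
    -- a node containing both, either one child contains both and the other
    -- neither, or the node is the lca and no cluster below it has both.
    separated-at-lca : ∀ (t : Tree n) → DisjointChildren t →
      ∀ {x y} → x ≢ y → x ∈ root t → y ∈ root t →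
      f (lca t x y) ≈ total-separation t x y
    separated-at-lca (leaf z) _ x≢y x∈ y∈ =
      contradiction (≡.trans (x∈⁅y⁆⇒x≡y z x∈) (≡.sym (x∈⁅y⁆⇒x≡y z y∈))) x≢y
    separated-at-lca (node l r) (disjoint , dˡ , dʳ) {x} {y} x≢y x∈ y∈
      with lca (node l r) x y | lcaView l r x y
    ... | _ | left x∈l y∈l = sym (begin-equality
      total-separation (node l r) x y  ≈⟨ total-separation-node l r x y ⟩
      _ ≈⟨ +-cong (separation-no _ x y λ where
              (inj₁ (_ , y∈r)) → disjoint y y∈l y∈r
              (inj₂ (x∈r , _)) → disjoint x x∈l x∈r)
            (+-cong (sym (separated-at-lca l dˡ x≢y x∈l y∈l))
                    (unseparated r {x} {y} λ (x∈r , _) → disjoint x x∈l x∈r)) ⟩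
      0# + (f (lca l x y) + 0#)  ≈⟨ trans (+-identityˡ _) (+-identityʳ _) ⟩
      f (lca l x y)              ∎)
    ... | _ | right x∈r y∈r = sym (begin-equality
      total-separation (node l r) x y  ≈⟨ total-separation-node l r x y ⟩
      _ ≈⟨ +-cong (separation-no _ x y λ where
              (inj₁ (x∈l , _)) → disjoint x x∈l x∈r
              (inj₂ (_ , y∈l)) → disjoint y y∈l y∈r)
            (+-cong (unseparated l {x} {y} λ (x∈l , _) → disjoint x x∈l x∈r)
                    (sym (separated-at-lca r dʳ x≢y x∈r y∈r))) ⟩
      0# + (0# + f (lca r x y))  ≈⟨ trans (+-identityˡ _) (+-identityˡ _) ⟩
      f (lca r x y)              ∎)
    ... | _ | split ¬l ¬r = sym (begin-equality
      total-separation (node l r) x y  ≈⟨ total-separation-node l r x y ⟩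
      _ ≈⟨ +-cong (separation-yes _ x y (across (x∈p∪q⁻ _ _ x∈) (x∈p∪q⁻ _ _ y∈)))
                  (+-cong (unseparated l {x} {y} ¬l) (unseparated r {x} {y} ¬r)) ⟩
      f (root (node l r)) + (0# + 0#)  ≈⟨ trans (+-congˡ (+-identityˡ 0#)) (+-identityʳ _) ⟩
      f (root (node l r))              ∎)
      where
      across : x ∈ root l ⊎ x ∈ root r → y ∈ root l ⊎ y ∈ root r →
               (x ∈ root l × y ∈ root r) ⊎ (x ∈ root r × y ∈ root l)
      across (inj₁ x∈l) (inj₁ y∈l) = contradiction (x∈l , y∈l) ¬l
      across (inj₁ x∈l) (inj₂ y∈r) = inj₁ (x∈l , y∈r)
      across (inj₂ x∈r) (inj₁ y∈l) = inj₂ (x∈r , y∈l)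
      across (inj₂ x∈r) (inj₂ y∈r) = contradiction (x∈r , y∈r) ¬r

    -- Exchange the sum over edges with the sum over clusters: for a fixed
    -- cluster the weights of the edges it separates add up to b.
    cost-by-cluster : (T : Hierarchy n) → let open Hierarchy T in
      edgeSum (λ x y → f (lca tree x y)) ≈
      Σˡ (λ S → f (Internal.cluster S) * b S) (internals tree)
    cost-by-cluster T = begin-equality
      edgeSum (λ x y → f (lca tree x y))
        ≈⟨ edgeSum-cong (λ x y adj → separated-at-lca tree (hierarchy-disjoint T)
             (λ x≡y → loopless x≡y adj) (hierarchy-full T x) (hierarchy-full T y)) ⟩
      edgeSum (total-separation tree)
        ≈⟨ edgeSum-Σˡ separation (internals tree) ⟩
      Σˡ (λ S → edgeSum (separation S)) (internals tree)
        ≈⟨ Σˡ-cong (All.universal (λ S →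
             sym (*-distribˡ-edgeSum (f (Internal.cluster S)) _)) (internals tree)) ⟩
      Σˡ (λ S → f (Internal.cluster S) * b S) (internals tree)  ∎
      where open Hierarchy T

-- The two costs of a hierarchy and the integral of the tail

module Comparison {ℝ : CompleteOrderedField} {n : ℕ} (2≤n : 2 ℕ.≤ n)
                  (G : WeightedGraph ℝ n) (T : Hierarchy n) where
  open CompleteOrderedField ℝ
  open OrderedField ℝ
  open Lebesgue ℝ
  open IntervalMeasure ℝ
  open ListSums ℝ
  open WeightedGraph G
  open GraphHierarchies G
  open Trees {n}
  open Clusters G
  open EdgeSums G
  open Hierarchy T
  open PartialOrderReasoning poset
  open CommutativeSemigroupProperties
    (Bundles.CommutativeMonoid.commutativeSemigroup *-commutativeMonoid)
    using () renaming (xy∙z≈xz∙y to xy*z≈xz*y; x∙yz≈y∙xz to x*yz≈y*xz)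

  some-edge : ∃[ x ] ∃[ y ] (x Fin.< y × Adj x y)
  some-edge = edge-at-zero 2≤n Adj loopless connected
    where
    edge-at-zero : ∀ {n} → 2 ℕ.≤ n → (R : Rel (Fin n) 0ℓ) →
      (∀ {x y} → x ≡ y → ¬ R x y) → (∀ x y → ∃[ k ] Walk R k x y) →
      ∃[ x ] ∃[ y ] (x Fin.< y × R x y)
    edge-at-zero (s≤s (s≤s _)) R loopless connected
      with connected Fin.zero (Fin.suc Fin.zero)
    ... | suc _ , Fin.zero  , adj , _ = contradiction adj (loopless ≡.refl)
    ... | suc _ , Fin.suc y , adj , _ = Fin.zero , Fin.suc y , s≤s z≤n , adj

  -- Some edge exists, and both its ends lie in their lca, whose diameter is
  -- therefore at least 1.
  F-positive : 0# < F T
  F-positive with some-edge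
  ... | x , y , x<y , adj = edgeSum-positive {λ x y → fromℕ (diam (lca tree x y))}
    (λ x y → fromℕ-nonNegative (diam (lca tree x y))) x<y adj
    (fromℕ-positive (ℕ.≤-trans (dist-positive λ x≡y → loopless x≡y adj)
                               (dist≤diam {lca tree x y} x∈ y∈)))
    where
    x∈ = proj₁ (∈-lca tree (hierarchy-full T x) (hierarchy-full T y))
    y∈ = proj₂ (∈-lca tree (hierarchy-full T x) (hierarchy-full T y))

  F≉0 : ¬ F T ≈ 0#
  F≉0 = 0<x⇒x≉0 F-positive

  -- The measure μ T of the single cluster S.
  mass : Internal n → Carrier
  mass S = a S * F T ⁻¹

  mass-nonNegative : ∀ S → 0# ≤ mass S
  mass-nonNegative S = *-nonNegative
    (*-nonNegative (fromℕ-nonNegative (Δ S))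
      (edgeSum-nonNegative λ x y → indicator-nonNegative (split? S x y)))
    (⁻¹-nonNegative F-positive)

  F*mass≈a : ∀ S → F T * mass S ≈ a S
  F*mass≈a S = begin-equality
    F T * (a S * F T ⁻¹)  ≈⟨ x*yz≈y*xz (F T) (a S) _ ⟩
    a S * (F T * F T ⁻¹)  ≈⟨ *-congˡ (⁻¹-inverseʳ (F T) F≉0) ⟩
    a S * 1#              ≈⟨ *-identityʳ (a S) ⟩
    a S                   ∎

  total-mass : F T * Σˡ mass (internals tree) ≈ F T
  total-mass = begin-equality
    F T * Σˡ mass (internals tree)             ≈⟨ *-distribˡ-Σˡ (F T) mass (internals tree) ⟩
    Σˡ (λ S → F T * mass S) (internals tree)   ≈⟨ Σˡ-cong (All.universal F*mass≈a (internals tree)) ⟩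
    Σˡ a (internals tree)                      ≈⟨ cost-by-cluster (λ S → fromℕ (diam S)) T ⟨
    F T                                        ∎

  -- The expectation of ρ - 1 under μ T.
  excess : Carrier
  excess = Σˡ (λ S → mass S * (ρ S - 1#)) (internals tree)

  module _ (conn : IsConnected T) where

    size-1 : Internal n → Carrier
    size-1 S = fromℕ (∣ Internal.cluster S ∣ ∸ 1)

    -- 1 ≤ Δ S ≤ |S| - 1 ≤ n - 1, divided by Δ S.
    ρ-bounds : All (λ S → 1# ≤ ρ S × ρ S ≤ fromℕ (n ∸ 1)) (internals tree)
    ρ-bounds = All.map bounds (Δ-bounds T conn)
      where
      bounds : ∀ {S} → 1 ℕ.≤ Δ S × Δ S ℕ.≤ ∣ Internal.cluster S ∣ ∸ 1 →
               1# ≤ ρ S × ρ S ≤ fromℕ (n ∸ 1)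
      bounds {S} (1≤Δ , Δ≤size) =
        x*z≤y⇒x≤y*z⁻¹ (fromℕ-positive 1≤Δ) (begin
          1# * fromℕ (Δ S)  ≈⟨ *-identityˡ _ ⟩
          fromℕ (Δ S)       ≤⟨ fromℕ-mono-≤ Δ≤size ⟩
          size-1 S          ∎) ,
        x≤y*z⇒x*z⁻¹≤y (fromℕ-positive 1≤Δ) (begin
          size-1 S          ≤⟨ fromℕ-mono-≤ (ℕ.∸-monoˡ-≤ 1 (∣p∣≤n (Internal.cluster S))) ⟩
          fromℕ (n ∸ 1)     ≈⟨ *-identityʳ _ ⟨
          fromℕ (n ∸ 1) * 1#  ≈⟨ *-congˡ (+-identityʳ 1#) ⟨
          fromℕ (n ∸ 1) * fromℕ 1
            ≤⟨ *-monoˡ-≤ (fromℕ-nonNegative (n ∸ 1)) (fromℕ-mono-≤ 1≤Δ) ⟩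
          fromℕ (n ∸ 1) * fromℕ (Δ S)  ∎)

    size-1*b≈a*ρ : All (λ S → size-1 S * b S ≈ a S * ρ S) (internals tree)
    size-1*b≈a*ρ = All.map cancel (Δ-bounds T conn)
      where
      cancel : ∀ {S} → 1 ℕ.≤ Δ S × Δ S ℕ.≤ ∣ Internal.cluster S ∣ ∸ 1 →
               size-1 S * b S ≈ a S * ρ S
      cancel {S} (1≤Δ , _) = sym (begin-equality
        (δ * b S) * (size-1 S * δ ⁻¹)  ≈⟨ x*yz≈y*xz _ (size-1 S) _ ⟩
        size-1 S * ((δ * b S) * δ ⁻¹)  ≈⟨ *-congˡ (xy*z≈xz*y δ (b S) _) ⟩
        size-1 S * ((δ * δ ⁻¹) * b S)
          ≈⟨ *-congˡ (*-congʳ (⁻¹-inverseʳ δ (0<x⇒x≉0 (fromℕ-positive 1≤Δ)))) ⟩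
        size-1 S * (1# * b S)          ≈⟨ *-congˡ (*-identityˡ (b S)) ⟩
        size-1 S * b S                 ∎)
        where δ = fromℕ (Δ S)

    -- Splitting ρ = 1 + (ρ - 1) under the expectation; the first part is the
    -- total mass.
    h-cost : edgeSum (λ x y → fromℕ (h T x y)) ≈ F T * (1# + excess)
    h-cost = begin-equality
      edgeSum (λ x y → fromℕ (h T x y))
        ≈⟨ edgeSum-cong (λ x y adj → if-elim (x Fin.≟ y) (λ k → fromℕ k ≈ size (lca tree x y))
             (λ x≡y → contradiction adj (loopless x≡y)) (λ _ → refl)) ⟩
      edgeSum (λ x y → size (lca tree x y))
        ≈⟨ cost-by-cluster size T ⟩
      Σˡ (λ S → size-1 S * b S) (internals tree)
        ≈⟨ Σˡ-cong (All.map (λ {S} eq → trans eq (scale S)) size-1*b≈a*ρ) ⟩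
      Σˡ (λ S → F T * (mass S + mass S * (ρ S - 1#))) (internals tree)
        ≈⟨ *-distribˡ-Σˡ (F T) _ (internals tree) ⟨
      F T * Σˡ (λ S → mass S + mass S * (ρ S - 1#)) (internals tree)
        ≈⟨ *-congˡ (Σˡ-distrib-+ mass _ (internals tree)) ⟩
      F T * (Σˡ mass (internals tree) + excess)
        ≈⟨ distribˡ (F T) _ excess ⟩
      F T * Σˡ mass (internals tree) + F T * excess
        ≈⟨ +-congʳ (trans total-mass (sym (*-identityʳ (F T)))) ⟩
      F T * 1# + F T * excess
        ≈⟨ distribˡ (F T) 1# excess ⟨
      F T * (1# + excess)  ∎
      where
      size : Subset n → Carrier
      size S = fromℕ (∣ S ∣ ∸ 1)

      scale : ∀ S → a S * ρ S ≈ F T * (mass S + mass S * (ρ S - 1#))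
      scale S = begin-equality
        a S * ρ S                                ≈⟨ *-congʳ (F*mass≈a S) ⟨
        (F T * mass S) * ρ S                     ≈⟨ *-assoc _ _ _ ⟩
        F T * (mass S * ρ S)                     ≈⟨ *-congˡ (*-congˡ (x-y+y≈x 1# (ρ S))) ⟨
        F T * (mass S * (ρ S - 1# + 1#))         ≈⟨ *-congˡ (*-congˡ (+-comm _ 1#)) ⟩
        F T * (mass S * (1# + (ρ S - 1#)))       ≈⟨ *-congˡ (distribˡ (mass S) 1# _) ⟩
        F T * (mass S * 1# + mass S * (ρ S - 1#))  ≈⟨ *-congˡ (+-congʳ (*-identityʳ (mass S))) ⟩
        F T * (mass S + mass S * (ρ S - 1#))     ∎

    ρ-at : ∀ i → 1# ≤ ρ (lookup (internals tree) i) ×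
                 ρ (lookup (internals tree) i) ≤ fromℕ (n ∸ 1)
    ρ-at i = All.lookup ρ-bounds (∈-lookup {xs = internals tree} i)

    -- The layer-cake decomposition of the tail.  A cluster S contributes its
    -- mass to the tail at t for all t < ρ S.  Taking 1 < t as well makes the
    -- piece an open interval and changes the integral by nothing.
    layers : Simple 1# (fromℕ (n ∸ 1))
    layers = record
      { size       = length (internals tree)
      ; coeff      = λ i → mass (S i)
      ; coeff≥0    = λ i → mass-nonNegative (S i)
      ; piece      = λ i → Open 1# (ρ (S i))
      ; piece?     = λ i t → (1# <? t) ×-dec (t <? ρ (S i))
      ; inside     = λ i t (1<t , t<ρ) → <⇒≤ 1<t , ≤-trans (<⇒≤ t<ρ) (proj₂ (ρ-at i))
      ; measurable = λ i → open-measurable 1# (ρ (S i))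
      ; measure    = λ i → ρ (S i) - 1#
      ; isMeasure  = λ i → open-measure (proj₁ (ρ-at i))
      }
      where
      S : Fin (length (internals tree)) → Internal n
      S = lookup (internals tree)

    layers-integral : Simple.integral layers ≈ excess
    layers-integral = sum-lookup (λ S → mass S * (ρ S - 1#)) (internals tree)

    -- Not an equality: at t = 1 the left-hand side vanishes.
    layers≤tail : ∀ t → Simple.value layers t ≤ μ T (λ S → t <? ρ S)
    layers≤tail t = begin
      Simple.value layers t
        ≤⟨ sum-mono-≤ (λ i → *-monoˡ-≤ (mass-nonNegative (S i)) (drop (t <? ρ (S i)))) ⟩
      sum (λ i → mass (S i) * indicator (t <? ρ (S i)))
        ≈⟨ sum-lookup (λ S → mass S * indicator (t <? ρ S)) (internals tree) ⟩
      Σˡ (λ S → mass S * indicator (t <? ρ S)) (internals tree)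
        ≈⟨ Σˡ-filter (λ S → t <? ρ S) mass (internals tree) ⟨
      μ T (λ S → t <? ρ S)  ∎
      where
      S : Fin (length (internals tree)) → Internal n
      S = lookup (internals tree)

      drop : ∀ {Q : Set} (Q? : Dec Q) → indicator ((1# <? t) ×-dec Q?) ≤ indicator Q?
      drop Q? = if-elim ((1# <? t) ×-dec Q?) (_≤ indicator Q?)
        (λ (_ , q) → ≤-reflexive (reflexive (≡.sym (indicator-yes Q? q))))
        (λ _ → indicator-nonNegative Q?)

    excess-nonNegative : 0# ≤ excess
    excess-nonNegative = ≤-trans
      (sum-nonNegative λ i →
        *-nonNegative (mass-nonNegative _) (x≤y⇒0≤y-x (proj₁ (ρ-at i))))
      (≤-reflexive layers-integral)

    excess≤integral : ∀ {Φ ∫Φ} →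
      (∀ t → [ 1# ⋯ fromℕ (n ∸ 1) ] t → μ T (λ S → t <? ρ S) ≤ Φ t) →
      IsIntegral 1# (fromℕ (n ∸ 1)) Φ ∫Φ → excess ≤ ∫Φ
    excess≤integral tail≤Φ (_ , above , _) = above excess
      (layers , (λ t t∈ → ≤-trans (layers≤tail t) (tail≤Φ t t∈)) , layers-integral)

theorem18 :
    (ℝ : CompleteOrderedField) →
    let open CompleteOrderedField ℝ
        open Lebesgue ℝ in
    (n : ℕ) → 2 ℕ.≤ n →
    (G : WeightedGraph ℝ n) →
    let open GraphHierarchies G
        n-1 = fromℕ (n ∸ 1) in
    (OPTfree OPTcard : Carrier) → IsOPTfree OPTfree → IsOPTcard OPTcard →
    (T : Hierarchy n) → IsConnected T →
    (α : Carrier) → 1# ≤ α → F T ≤ α * OPTfree →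
    (Φ : Carrier → Carrier) →
    (∀ {s t} → [ 1# ⋯ n-1 ] s → [ 1# ⋯ n-1 ] t → s ≈ t → Φ s ≈ Φ t) →
    (∀ t → [ 1# ⋯ n-1 ] t → 0# ≤ Φ t) →
    (∀ t → [ 1# ⋯ n-1 ] t → μ T (λ S → t <? ρ S) ≤ Φ t) →
    (∫Φ : Carrier) → IsIntegral 1# n-1 Φ ∫Φ →
    OPTcard ≤ (α * (1# + ∫Φ)) * OPTfree
theorem18 ℝ n 2≤n G OPTfree OPTcard _ (_ , OPTcard-minimal) T conn α _ F≤αOPT
          Φ _ _ tail≤Φ ∫Φ isIntegral = begin
  OPTcard                            ≤⟨ OPTcard-minimal _ (T , h-dominates T conn , refl) ⟩
  edgeSum (λ x y → fromℕ (h T x y))  ≈⟨ h-cost conn ⟩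
  F T * (1# + excess)                ≤⟨ *-monoˡ-≤ (<⇒≤ F-positive) (+-monoʳ-≤ 1# excess≤∫Φ) ⟩
  F T * (1# + ∫Φ)                    ≤⟨ *-monoʳ-≤ 0≤1+∫Φ F≤αOPT ⟩
  (α * OPTfree) * (1# + ∫Φ)          ≈⟨ xy*z≈xz*y α OPTfree (1# + ∫Φ) ⟩
  (α * (1# + ∫Φ)) * OPTfree          ∎
  where
  open CompleteOrderedField ℝ
  open OrderedField ℝ
  open GraphHierarchies G
  open Clusters G
  open Comparison 2≤n G T
  open PartialOrderReasoning poset
  open CommutativeSemigroupProperties
    (Bundles.CommutativeMonoid.commutativeSemigroup *-commutativeMonoid)
    using () renaming (xy∙z≈xz∙y to xy*z≈xz*y)

  excess≤∫Φ : excess ≤ ∫Φ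
  excess≤∫Φ = excess≤integral conn tail≤Φ isIntegral

  0≤1+∫Φ : 0# ≤ 1# + ∫Φ
  0≤1+∫Φ = +-nonNegative 0≤1 (≤-trans (excess-nonNegative conn) excess≤∫Φ)
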